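{- Let $A$ be an $\omega\times\omega$ monic segmented first entries matrix with entries from $\omega$. Let $r\in\mathbb N$ and let $\mathbb N=\bigcup_{i=1}^r E_i$ be an $r$-coloring of $\mathbb N$. Then there exist $i\in\{1,2,\dots,r\}$ and vectors $\vec x,\vec y\in\mathbb N^\omega$ such that all the entries of $A\vec x$ and all the entries of $\vec y^{A}$ are in $E_i$.
   Context: $\mathbb N=\{1,2,3,\dots\}$, $\omega=\{0,1,2,\dots\}$. First entries matrix: a finite matrix with rational entries is a first entries matrix if (1) no row is $\vec 0$; (2) the first nonzero entry of each row is positive; (3) the first nonzero entries of any two rows are equal if they occur in the same column. Monic segmented first entries matrix: an $\omega\times\omega$ matrix $A=(a_{ij})$ with rational entries such that (1) no row of $A$ is $\vec 0$; (2) for each $i\in\omega$, $\{j\in\omega: a_{ij}\ne 0\}$ is finite; (3) there is an increasing sequence $\{\alpha_n\}_{n=0}^\infty$ in $\omega$ with $\alpha_0=0$ such that for each $n\in\omega$ the set $\{(a_{i,\alpha_n},a_{i,\alpha_n+1},\dots,a_{i,\alpha_{n+1}-1}): i\in\omega\}\setminus\{\vec 0\}$ is empty or is the set of rows of a finite first entries matrix, and the first nonzero entry of each nonzero vector $(a_{i,\alpha_n},a_{i,\alpha_n+1},\dots,a_{i,\alpha_{n+1}-1})$ is $1$. For $\vec y=(y_j)_{j\in\omega}\in\mathbb N^\omega$, $\vec y^{A}$ is the vector whose $i$-th entry is $\prod_{j} y_j^{a_{ij}}$. -}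

module Defs where

open import Data.Fin using (Fin; toℕ) renaming (_<_ to _<ᶠ_)
open import Data.Integer using (+_)
open import Data.List using (applyUpTo)
open import Data.Nat using (ℕ; suc; _+_; _*_; _∸_; _^_; _<_)
open import Data.Nat.ListAction using (sum; product)
open import Data.Product using (∃; _×_; proj₁)
open import Data.Rational as ℚ using (ℚ; 0ℚ; 1ℚ)
open import Data.Sum using (_⊎_)
open import Level using (0ℓ)
open import Relation.Binary.PropositionalEquality using (_≡_; _≢_; _≗_)
open import Relation.Unary using (Pred; Empty; _≐_)

RowVec : ℕ → Set
RowVec v = Fin v → ℚ

NonzeroVec : ∀ {v} → Pred (RowVec v) 0ℓ
NonzeroVec w = ∃ λ k → w k ≢ 0ℚ

FirstNonzeroAt : ∀ {v} → RowVec v → Fin v → Set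
FirstNonzeroAt w k = w k ≢ 0ℚ × (∀ l → l <ᶠ k → w l ≡ 0ℚ)

record IsFirstEntries {u v : ℕ} (M : Fin u → RowVec v) : Set where
  field
    row-nonzero    : ∀ i → NonzeroVec (M i)
    first-positive : ∀ i k → FirstNonzeroAt (M i) k → 0ℚ ℚ.< M i k
    first-equal    : ∀ i j k → FirstNonzeroAt (M i) k → FirstNonzeroAt (M j) k →
                     M i k ≡ M j k

-- Vectors are functions and function extensionality is not available, so sets
-- of vectors are taken up to pointwise equality _≗_.
Rows : ∀ {u v} → (Fin u → RowVec v) → Pred (RowVec v) 0ℓ
Rows M w = ∃ λ i → w ≗ M i

-- The entries of row i in the columns s, s + 1, …, e - 1.
segment : (A : ℕ → ℕ → ℚ) (s e : ℕ) → ℕ → RowVec (e ∸ s)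
segment A s e i k = A i (s + toℕ k)

NonzeroSegments : (A : ℕ → ℕ → ℚ) (s e : ℕ) → Pred (RowVec (e ∸ s)) 0ℓ
NonzeroSegments A s e w = NonzeroVec w × ∃ λ i → w ≗ segment A s e i

record IsMonicSegmentedFirstEntries (A : ℕ → ℕ → ℚ) : Set where
  field
    row-nonzero : ∀ i → ∃ λ j → A i j ≢ 0ℚ
    -- A set of natural numbers is finite exactly when it is bounded.
    row-finite  : ∀ i → ∃ λ N → ∀ j → A i j ≢ 0ℚ → j < N
    α           : ℕ → ℕ
    α-zero      : α 0 ≡ 0
    α-increasing : ∀ n → α n < α (suc n)
    segments    : ∀ n → let S = NonzeroSegments A (α n) (α (suc n)) in
                  Empty S ⊎
                  ∃ λ u → ∃ λ (M : Fin u → RowVec (α (suc n) ∸ α n)) →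
                    IsFirstEntries M × S ≐ Rows M
    monic       : ∀ n i k → FirstNonzeroAt (segment A (α n) (α (suc n)) i) k →
                  segment A (α n) (α (suc n)) i k ≡ 1ℚ

toℚ : (ℕ → ℕ → ℕ) → (ℕ → ℕ → ℚ)
toℚ A i j = + A i j ℚ./ 1

module _ (A : ℕ → ℕ → ℕ) (isA : IsMonicSegmentedFirstEntries (toℚ A)) where
  open IsMonicSegmentedFirstEntries isA

  -- Row i vanishes from column N i on, so truncating at N i drops only
  -- summands 0 * x j and factors y j ^ 0; any other bound on the support of
  -- the row gives the same sum and product.
  private
    N : ℕ → ℕ
    N i = proj₁ (row-finite i)

  -- (A x⃗)ᵢ = Σⱼ aᵢⱼ xⱼ
  linearImage : (ℕ → ℕ) → ℕ → ℕ
  linearImage x i = sum (applyUpTo (λ j → A i j * x j) (N i))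

  -- (y⃗ᴬ)ᵢ = Πⱼ yⱼ ^ aᵢⱼ
  powerImage : (ℕ → ℕ) → ℕ → ℕ
  powerImage y i = product (applyUpTo (λ j → y j ^ A i j) (N i))

-- The paper's ℕ = {1, 2, 3, …}.
Positive : Pred ℕ 0ℓ
Positive n = 0 < n

{-# OPTIONS --safe #-}

-- An additive filter φ (A ∈ φ implies {s : {t : s ∙ t ∈ A} ∈ φ} ∈ φ) stands for a
-- closed subsemigroup of the Stone–Čech compactification.  By the Hales–Jewett theorem
-- the sets whose complement is not a J-set form such a filter, and it is proper even
-- relative to a thick set U.  Given a finite colouring, the Ellis argument, carried out
-- for countably many sets only and hence without ultrafilters or Zorn's lemma, extends
-- it to an additive filter Θ containing U and one colour class.  Every member of Θ is a
-- J-set, so it contains first entries images, one column at a time, and Hindman's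
-- construction assembles the images for the successive segments of the matrix.
--
-- Call a colour good if its class contains all entries of some A x⃗.  If the union of
-- the good classes were not multiplicatively thick, then the bad classes, divided by
-- finitely many numbers, would cover {1, 2, 3, …}, against the additive theorem.  So the
-- multiplicative theorem, relative to this thick set, provides the colour.
module Submission where

open import Defs
open import Algebra.Bundles using (CommutativeMonoid)
open import Algebra.Structures using (IsCommutativeMonoid)
open import Axiom.ExcludedMiddle using (ExcludedMiddle)
open import Data.Bool using (Bool; true; false; T)
open import Data.Empty using (⊥; ⊥-elim)
open import Data.Fin as Fin
  using (Fin; zero; suc; toℕ; fromℕ<; splitAt; _↑ˡ_; _↑ʳ_; combine; remQuot)
open import Data.Fin.Properties
  using (splitAt-↑ˡ; splitAt-↑ʳ; toℕ<n; toℕ-fromℕ<; toℕ-injective; remQuot-combine)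
open import Data.Integer using () renaming (+_ to pos)
import Data.Integer.Properties as ℤ
open import Data.List as List
  using (List; []; _∷_; length; cartesianProductWith; allFin; upTo; applyUpTo)
open import Data.List.Membership.Propositional using (_─_) renaming (_∈_ to _∈ˡ_)
open import Data.List.Membership.Propositional.Properties
  using (∈-cartesianProductWith⁺; ∈-allFin; ∈-upTo⁺; ∈-++⁺ˡ; ∈-++⁺ʳ; ∈-++⁻; ∈-map⁺; ∈-map⁻)
open import Data.List.Properties using (length-removeAt′)
open import Data.List.Relation.Unary.Any as LAny using (here; there; index)
open import Data.List.Relation.Unary.Any.Properties using (lookup-index)
open import Data.Maybe as Maybe using (Maybe; just; nothing; fromMaybe)
open import Data.Nat
  using (ℕ; zero; suc; NonZero; _+_; _*_; _^_; _∸_; _⊔_; _≤_; _<_; z≤n; s≤s; z<s; s<s⁻¹; _≟_; _<?_)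
open import Data.Nat.ListAction using (sum; product)
open import Data.Nat.Properties
open import Data.Product using (∃; _×_; _,_; proj₁; proj₂)
open import Data.Rational as ℚ using ()
open import Data.Rational.Properties using (/-injective-≃)
open import Data.Rational.Unnormalised using (mkℚᵘ; *≡*)
open import Data.Sum as Sum using (_⊎_; inj₁; inj₂; fromInj₂)
open import Data.Unit using (⊤; tt)
open import Data.Vec as Vec using (Vec; []; _∷_; _++_; fromList; tabulate; replicate)
open import Data.Vec.Functional using () renaming (_∷_ to _∷ᶠ_)
import Data.Vec.Properties as Vec
open import Data.Vec.Relation.Unary.All as VAll using ([]; _∷_)
import Data.Vec.Relation.Unary.All.Properties as VAll
open import Data.Vec.Relation.Unary.Any as VAny using (here; there)
import Data.Vec.Relation.Unary.Any.Properties as VAny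
open import Function using (_∘_; id)
open import Level using (0ℓ)
open import Relation.Binary.PropositionalEquality
open import Relation.Nullary using (¬_; Dec; yes; no; does)
open import Relation.Unary using (Pred; _∈_; _≐_; ⋃)

-- The Hales–Jewett theorem

vecs : {A : Set} → List A → ∀ n → List (Vec A n)
vecs L zero    = [] ∷ []
vecs L (suc n) = cartesianProductWith _∷_ L (vecs L n)

∈-vecs : ∀ {A : Set} {L : List A} {n} {v : Vec A n} → VAll.All (_∈ˡ L) v → v ∈ˡ vecs L n
∈-vecs []         = here refl
∈-vecs (p ∷ ps) = ∈-cartesianProductWith⁺ _∷_ p (∈-vecs ps)

words : ∀ k n → List (Vec (Fin k) n)
words k = vecs (allFin k)

∈-words : ∀ {k n} (w : Vec (Fin k) n) → w ∈ˡ words k n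
∈-words w = ∈-vecs (VAll.universal ∈-allFin w)

coefs : ℕ → ∀ v → List (Vec ℕ v)
coefs K = vecs (upTo (suc K))

-- The rows with first nonzero entry 1 and all later entries at most K.
rows : ℕ → ∀ v → List (Vec ℕ v)
rows K zero    = []
rows K (suc v) = List.map (1 ∷_) (coefs K v) List.++ List.map (0 ∷_) (rows K v)

map-fromList-agree : ∀ {A B : Set} {f g : A → B} (xs : List A) →
  Vec.map f (fromList xs) ≡ Vec.map g (fromList xs) → ∀ {x} → x ∈ˡ xs → f x ≡ g x
map-fromList-agree (_ ∷ _)  eq (here refl) = Vec.∷-injectiveˡ eq
map-fromList-agree (_ ∷ xs) eq (there p)   = map-fromList-agree xs (Vec.∷-injectiveʳ eq) p

-- Variable words, with `nothing` in the places of the variable.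
Line : ℕ → ℕ → Set
Line k n = Vec (Maybe (Fin k)) n

infixl 8 _·_
_·_ : ∀ {k n} → Line k n → Fin k → Vec (Fin k) n
ℓ · x = Vec.map (fromMaybe x) ℓ

Wild : ∀ {k n} → Line k n → Set
Wild = VAny.Any (_≡ nothing)

const-· : ∀ {k n} (w : Vec (Fin k) n) x → Vec.map just w · x ≡ w
const-· []      x = refl
const-· (_ ∷ w) x = cong (_ ∷_) (const-· w x)

++-· : ∀ {k m n} (ℓ : Line k m) (ℓ′ : Line k n) x → (ℓ ++ ℓ′) · x ≡ ℓ · x ++ ℓ′ · x
++-· ℓ ℓ′ x = Vec.map-++ (fromMaybe x) ℓ ℓ′

lift : ∀ {k n} → Line k n → Line (suc k) n
lift = Vec.map (Maybe.map suc)

lift-· : ∀ {k n} (ℓ : Line k n) x → lift ℓ · suc x ≡ Vec.map suc (ℓ · x)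
lift-· []            x = refl
lift-· (just _ ∷ ℓ)  x = cong (_ ∷_) (lift-· ℓ x)
lift-· (nothing ∷ ℓ) x = cong (_ ∷_) (lift-· ℓ x)

lift-wild : ∀ {k n} {ℓ : Line k n} → Wild ℓ → Wild (lift ℓ)
lift-wild (here refl) = here refl
lift-wild (there p)   = there (lift-wild p)

MonoLine : ∀ {K : Set} k n → (Vec (Fin (suc k)) n → K) → Set
MonoLine k n C = ∃ λ (ℓ : Line (suc k) n) → Wild ℓ × ∀ x → C (ℓ · x) ≡ C (ℓ · zero)

-- Colours come from any type, with a list `L` of those allowed, so that vectors of colours can
-- serve as colours in the induction.
HalesJewett : ℕ → Set₁
HalesJewett k = (K : Set) (L : List K) → ∃ λ n →
  (C : Vec (Fin (suc k)) n → K) → (∀ w → C w ∈ˡ L) → MonoLine k n C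

module ColourFocusing (k : ℕ) (hj : HalesJewett k) (K : Set) (L : List K) where

  -- A line of the colour focusing argument. Once its focus `x` has the colour `c` too, the line is
  -- monochromatic.
  Spoke : ∀ {n} → (Vec (Fin (2 + k)) n → K) → Vec (Fin (2 + k)) n → K → Set
  Spoke C x c = ∃ λ ℓ → Wild ℓ × ℓ · zero ≡ x × ∀ a → C (ℓ · suc a) ≡ c

  -- The list R holds the colours that have no spoke yet.
  Focused : ∀ {n} → ℕ → (Vec (Fin (2 + k)) n → K) → Set
  Focused s C = ∃ λ x → ∃ λ R → length R ≡ s × ∀ {c} → c ∈ˡ L → c ∈ˡ R ⊎ Spoke C x c

  Focusing : ℕ → Set
  Focusing s = ∃ λ n → (C : Vec (Fin (2 + k)) n → K) → (∀ w → C w ∈ˡ L) →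
    MonoLine (suc k) n C ⊎ Focused s C

  mono : ∀ {n C} {x : Vec (Fin (2 + k)) n} → Spoke C x (C x) → MonoLine (suc k) n C
  mono {C = C} (ℓ , wild , refl , eq) = ℓ , wild , λ where
    zero    → refl
    (suc a) → eq a

  start : Focusing (length L)
  start = 0 , λ C _ → inj₂ ([] , L , refl , inj₁)

  remove : ∀ {R : List K} {c} (c∈R : c ∈ˡ R) {d} → d ∈ˡ R → d ≡ c ⊎ d ∈ˡ (R ─ c∈R)
  remove (here refl) (here refl) = inj₁ refl
  remove (here refl) (there q)   = inj₂ q
  remove (there p)   (here refl) = inj₂ (here refl)
  remove (there p)   (there q) with remove p q
  ... | inj₁ eq = inj₁ eq
  ... | inj₂ r  = inj₂ (there r)

  -- Prefixes are coloured by the vector of colours that all suffixes give them. The hypothesis for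
  -- one letter fewer yields a prefix line `ℓ` whose letters `suc a` are indistinguishable, whatever
  -- the suffix. Old spokes are prolonged by `ℓ`.
  step : ∀ {s} → Focusing (suc s) → Focusing s
  step {s} (n₁ , focus) = n₂ + n₁ , extend
    where
    ws = words (2 + k) n₁
    hj′ = hj (Vec K (length ws)) (vecs L (length ws))
    n₂ = proj₁ hj′

    extend : (C : Vec (Fin (2 + k)) (n₂ + n₁) → K) → (∀ w → C w ∈ˡ L) →
      MonoLine (suc k) (n₂ + n₁) C ⊎ Focused s C
    extend C C∈L = conclude (focus C₁ (λ _ → C∈L _))
      where
      stack : Vec (Fin (suc k)) n₂ → Vec K (length ws)
      stack w = Vec.map (λ u → C (Vec.map suc w ++ u)) (fromList ws)

      monoStack : MonoLine k n₂ stack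
      monoStack = proj₂ hj′ stack
        (λ w → ∈-vecs (VAll.map⁺ (VAll.universal (λ _ → C∈L _) (fromList ws))))

      ℓ = lift (proj₁ monoStack)

      C₁ : Vec (Fin (2 + k)) n₁ → K
      C₁ u = C (ℓ · suc zero ++ u)

      constant : ∀ a u → C (ℓ · suc a ++ u) ≡ C₁ u
      constant a u rewrite lift-· (proj₁ monoStack) a | lift-· (proj₁ monoStack) zero =
        map-fromList-agree ws (proj₂ (proj₂ monoStack) a) (∈-words u)

      prolong : ∀ {x c} → Spoke C₁ x c → Spoke C (ℓ · zero ++ x) c
      prolong (m , wild , refl , eq) =
        ℓ ++ m , VAny.++⁺ʳ ℓ wild , ++-· ℓ m zero ,
        λ a → trans (cong C (++-· ℓ m (suc a))) (trans (constant a _) (eq a))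

      newSpoke : ∀ x → Spoke C (ℓ · zero ++ x) (C₁ x)
      newSpoke x =
        ℓ ++ Vec.map just x , VAny.++⁺ˡ (lift-wild (proj₁ (proj₂ monoStack))) ,
        trans (++-· ℓ _ zero) (cong (_ ++_) (const-· x zero)) ,
        λ a → trans (cong C (trans (++-· ℓ _ (suc a)) (cong (_ ++_) (const-· x (suc a)))))
                    (constant a x)

      monoExtend : MonoLine (suc k) n₁ C₁ → MonoLine (suc k) (n₂ + n₁) C
      monoExtend (m , wild , eq) =
        Vec.map just (ℓ · suc zero) ++ m , VAny.++⁺ʳ (Vec.map just (ℓ · suc zero)) wild ,
        λ x → trans (cong C (apply x)) (trans (eq x) (sym (cong C (apply zero))))
        where
        apply : ∀ x → (Vec.map just (ℓ · suc zero) ++ m) · x ≡ ℓ · suc zero ++ m · x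
        apply x = trans (++-· _ m x) (cong (_++ _) (const-· (ℓ · suc zero) x))

      conclude : MonoLine (suc k) n₁ C₁ ⊎ Focused (suc s) C₁ →
        MonoLine (suc k) (n₂ + n₁) C ⊎ Focused s C
      conclude (inj₁ line) = inj₁ (monoExtend line)
      -- The colour `C₁ x` decides: a spoke of this colour is monochromatic together with its focus;
      -- otherwise `ℓ` followed by the constant word `x` is a spoke that removes the colour from
      -- `R`.
      conclude (inj₂ (x , R , len , spokes)) with spokes (C∈L (ℓ · suc zero ++ x))
      ... | inj₂ spoke = inj₁ (monoExtend (mono spoke))
      ... | inj₁ c∈R   = inj₂ (ℓ · zero ++ x , R ─ c∈R ,
                               suc-injective (trans (sym (length-removeAt′ R (index c∈R))) len) ,
                               spokes′)
        where
        spokes′ : ∀ {c} → c ∈ˡ L → c ∈ˡ (R ─ c∈R) ⊎ Spoke C (ℓ · zero ++ x) c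
        spokes′ c∈L with spokes c∈L
        ... | inj₂ spoke = inj₂ (prolong spoke)
        ... | inj₁ c′∈R with remove c∈R c′∈R
        ...   | inj₁ refl = inj₂ (newSpoke x)
        ...   | inj₂ rest = inj₁ rest

  descend : ∀ s → Focusing s → Focusing 0
  descend zero    f = f
  descend (suc s) f = descend s (step f)

  halesJewett-suc : ∃ λ n → (C : Vec (Fin (2 + k)) n → K) → (∀ w → C w ∈ˡ L) →
    MonoLine (suc k) n C
  halesJewett-suc with descend (length L) start
  ... | n , focus = n , λ C C∈L → finish C C∈L (focus C C∈L)
    where
    finish : ∀ C → (∀ w → C w ∈ˡ L) → MonoLine (suc k) n C ⊎ Focused 0 C → MonoLine (suc k) n C
    finish C C∈L (inj₁ line) = line
    finish C C∈L (inj₂ (x , [] , _ , spokes)) with spokes (C∈L x)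
    ... | inj₂ spoke = mono spoke

abstract
  halesJewett : ∀ k → HalesJewett k
  halesJewett zero    K L = 1 , λ C _ → nothing ∷ [] , here refl , λ { zero → refl }
  halesJewett (suc k) K L = ColourFocusing.halesJewett-suc k (halesJewett k) K L

-- Segmented matrices over ℕ

module Segmentation (α : ℕ → ℕ) (α-zero : α 0 ≡ 0) (α-increasing : ∀ n → α n < α (suc n)) where

  width : ℕ → ℕ
  width n = α (suc n) ∸ α n

  α+width : ∀ n → α n + width n ≡ α (suc n)
  α+width n = m+[n∸m]≡n (<⇒≤ (α-increasing n))

  α-mono-+ : ∀ d n → α n ≤ α (d + n)
  α-mono-+ zero    n = ≤-refl
  α-mono-+ (suc d) n = ≤-trans (α-mono-+ d n) (<⇒≤ (α-increasing (d + n)))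

  α-mono : ∀ {m n} → m ≤ n → α m ≤ α n
  α-mono {m} {n} m≤n = subst (λ k → α m ≤ α k) (m∸n+n≡m m≤n) (α-mono-+ (n ∸ m) m)

  n≤αn : ∀ n → n ≤ α n
  n≤αn zero    = z≤n
  n≤αn (suc n) = ≤-<-trans (n≤αn n) (α-increasing n)

  locate-below : ∀ m {j} → j < α m → ∃ λ n → ∃ λ (k : Fin (width n)) → α n + toℕ k ≡ j
  locate-below zero    {j} j<α = ⊥-elim (n≮0 (subst (j <_) α-zero j<α))
  locate-below (suc m) {j} j<α with j <? α m
  ... | yes j<αm = locate-below m j<αm
  ... | no j≮αm  = m , fromℕ< (∸-monoˡ-< j<α (≮⇒≥ j≮αm)) ,
    trans (cong (α m +_) (toℕ-fromℕ< _)) (m+[n∸m]≡n (≮⇒≥ j≮αm))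

  locate : ∀ j → ∃ λ n → ∃ λ (k : Fin (width n)) → α n + toℕ k ≡ j
  locate j = locate-below (suc j) (n≤αn (suc j))

  segment-bound : ∀ n (k : Fin (width n)) → α n + toℕ k < α (suc n)
  segment-bound n k = <-≤-trans (+-monoʳ-< (α n) (toℕ<n k)) (≤-reflexive (α+width n))

  segment-≤ : ∀ {n n′} (k : Fin (width n)) (k′ : Fin (width n′)) →
    α n + toℕ k ≡ α n′ + toℕ k′ → n ≤ n′
  segment-≤ {n} {n′} k k′ eq = ≮⇒≥ λ n′<n → <-irrefl (sym eq)
    (<-≤-trans (segment-bound n′ k′) (≤-trans (α-mono n′<n) (m≤m+n (α n) (toℕ k))))

  glue : (∀ n → Fin (width n) → ℕ) → ℕ → ℕ
  glue o j = let (n , k , _) = locate j in o n k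

  glue-at : ∀ o n k → glue o (α n + toℕ k) ≡ o n k
  glue-at o n k = agree (proj₁ (proj₂ (locate j))) (proj₂ (proj₂ (locate j)))
    where
    j = α n + toℕ k
    agree : ∀ {n′} (k′ : Fin (width n′)) → α n′ + toℕ k′ ≡ α n + toℕ k → o n′ k′ ≡ o n k
    agree k′ eq with ≤-antisym (segment-≤ k′ k eq) (segment-≤ k k′ (sym eq))
    ... | refl = cong (o n) (toℕ-injective (+-cancelˡ-≡ (α n) _ _ eq))

-- The form in which the hypothesis on the matrix enters: the nonzero segments at place `n`, over
-- all rows `i`, come from one finite list.
record Segmented (A : ℕ → ℕ → ℕ) : Set where
  field
    α            : ℕ → ℕ
    α-zero       : α 0 ≡ 0
    α-increasing : ∀ n → α n < α (suc n)
  open Segmentation α α-zero α-increasing public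
  field
    K       : ℕ → ℕ
    nonzero : ∀ i → ∃ λ j → A i j ≢ 0
    segment-row : ∀ n i → (∀ (k : Fin (width n)) → A i (α n + toℕ k) ≡ 0) ⊎
      tabulate (λ (k : Fin (width n)) → A i (α n + toℕ k)) ∈ˡ rows (K n) (width n)

-- Additive filters

module Classical (em : ExcludedMiddle 0ℓ) where

  ⌊_⌋ : Set → Bool
  ⌊ P ⌋ = does (em {P})

  tick : ∀ {P} → P → T ⌊ P ⌋
  tick {P} p with em {P}
  ... | yes _ = _
  ... | no ¬p = ¬p p

  untick : ∀ {P} → T ⌊ P ⌋ → P
  untick {P} t with em {P}
  ... | yes p = p

  dne : ∀ {P : Set} → ¬ ¬ P → P
  dne {P} ¬¬p with em {P}
  ... | yes p = p
  ... | no ¬p = ⊥-elim (¬¬p ¬p)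

module Ramsey (em : ExcludedMiddle 0ℓ)
  (_∙_ : ℕ → ℕ → ℕ) (ε : ℕ) (isCM : IsCommutativeMonoid _≡_ _∙_ ε) where

  open IsCommutativeMonoid isCM using (assoc; comm; identityˡ; identityʳ)

  commutativeMonoid : CommutativeMonoid 0ℓ 0ℓ
  commutativeMonoid = record { isCommutativeMonoid = isCM }

  open import Algebra.Properties.CommutativeMonoid.Mult commutativeMonoid
    using (×-distrib-+) renaming (_×_ to infixr 8 _⋆_) public
  open Classical em

  swapˡ : ∀ a b c → a ∙ (b ∙ c) ≡ b ∙ (a ∙ c)
  swapˡ a b c = trans (sym (assoc a b c)) (trans (cong (_∙ c) (comm a b)) (assoc b a c))

  -- Subsets and families of subsets are Bool-valued in order to stay in Set, where
  -- excluded middle decides statements that quantify over them.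
  Subset : Set
  Subset = ℕ → Bool

  Family : Set
  Family = Subset → Bool

  -- `meet` merges closure under intersections with closure under supersets; `point` is properness.
  record IsFilter (φ : Family) : Set where
    field
      meet  : ∀ {A B C} → (∀ x → T (A x) → T (B x) → T (C x)) → T (φ A) → T (φ B) → T (φ C)
      top   : ∀ {A} → (∀ x → T (A x)) → T (φ A)
      point : ∀ {A} → T (φ A) → ∃ λ x → T (A x)

    up : ∀ {A B} → (∀ x → T (A x) → T (B x)) → T (φ A) → T (φ B)
    up A⊆B p = meet (λ x a _ → A⊆B x a) p p

  -- The set of ultrafilters containing an additive filter is a closed subsemigroup.
  IsAdditive : Family → Set
  IsAdditive φ = ∀ {A} → T (φ A) → T (φ (λ s → φ (λ t → A (s ∙ t))))

  _⊑_ : Family → Family → Set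
  φ ⊑ ψ = ∀ {A} → T (φ A) → T (ψ A)

  ⟦_⟧ : (ℕ → Set) → Subset
  ⟦ P ⟧ x = ⌊ P x ⌋

  record AdditiveFilter : Set where
    field
      family   : Family
      isFilter : IsFilter family
      additive : IsAdditive family
    open IsFilter isFilter public

  open AdditiveFilter

  Decreasing : (ℕ → ℕ → Set) → Set
  Decreasing P = ∀ {m n x} → m ≤ n → P n x → P m x

  record Generates (φ : Family) (P : ℕ → ℕ → Set) (A : Subset) : Set where
    constructor generates
    field
      level    : ℕ
      {member} : Subset
      isMember : T (φ member)
      sub      : ∀ x → T (member x) → P level x → T (A x)

  _∨_ : Family → (ℕ → ℕ → Set) → Family
  (φ ∨ P) A = ⌊ Generates φ P A ⌋

  module Join {φ : Family} (isF : IsFilter φ) (P : ℕ → ℕ → Set) (dec : Decreasing P)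
    (compatible : ∀ n {B} → T (φ B) → ∃ λ x → T (B x) × P n x) where

    private module φ = IsFilter isF

    ⊑-join : φ ⊑ (φ ∨ P)
    ⊑-join p = tick (generates 0 p λ _ b _ → b)

    base : ∀ n {A} → (∀ x → P n x → T (A x)) → T ((φ ∨ P) A)
    base n P⊆A = tick (generates n {⟦ (λ _ → ⊤) ⟧} (φ.top (λ _ → tick tt)) λ x _ → P⊆A x)

    join-isFilter : IsFilter (φ ∨ P)
    join-isFilter = record
      { meet  = λ {A} {B} {C} sub p q → meet′ {A} {B} {C} sub (untick p) (untick q)
      ; top   = λ all → base 0 (λ x _ → all x)
      ; point = λ {A} p → point′ {A} (untick p)
      }
      where
      meet′ : ∀ {A B C} → (∀ x → T (A x) → T (B x) → T (C x)) →
        Generates φ P A → Generates φ P B → T ((φ ∨ P) C)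
      meet′ sub (generates m {D} d ⊆A) (generates n {E} e ⊆B) =
        tick (generates (m ⊔ n) {⟦ (λ x → T (D x) × T (E x)) ⟧} (φ.meet (λ x a b → tick (a , b)) d e)
          λ x de p → sub x (⊆A x (proj₁ (untick de)) (dec (m≤m⊔n m n) p))
                           (⊆B x (proj₂ (untick de)) (dec (m≤n⊔m m n) p)))

      point′ : ∀ {A} → Generates φ P A → ∃ λ x → T (A x)
      point′ (generates n d ⊆A) with compatible n d
      ... | x , inD , inP = x , ⊆A x inD inP

    -- Only the generators `P n` need checking, since members of `φ` inherit additivity from `φ`.
    join-isAdditive : IsAdditive φ →
      (∀ n → T ((φ ∨ P) ⟦ (λ s → T ((φ ∨ P) ⟦ (λ t → P n (s ∙ t)) ⟧)) ⟧)) → IsAdditive (φ ∨ P)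
    join-isAdditive add shift p with untick p
    ... | generates n d ⊆A =
      join.meet (λ s d′ p′ → join.meet (λ t d″ p″ → ⊆A (s ∙ t) d″ (untick p″)) (⊑-join d′) (untick p′))
                (⊑-join (add d)) (shift n)
      where module join = IsFilter join-isFilter

  -- If q is an ultrafilter containing ψ and C the closed semigroup of φ then C ∙ q
  -- is again a closed semigroup, contained in C.
  _∗_ : Family → Family → Family
  (φ ∗ ψ) A = φ (λ s → ψ (λ t → A (s ∙ t)))

  module Product (Φ : AdditiveFilter) {ψ : Family} (isF : IsFilter ψ) (φ⊑ψ : family Φ ⊑ ψ) where

    private
      module Φ = AdditiveFilter Φ
      module ψ = IsFilter isF
      φ = family Φ

    ⊑-product : φ ⊑ (φ ∗ ψ)
    ⊑-product p = Φ.up (λ _ → φ⊑ψ) (Φ.additive p)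

    productFilter : AdditiveFilter
    productFilter = record
      { family   = φ ∗ ψ
      ; isFilter = record
        { meet  = λ sub → Φ.meet (λ s → ψ.meet (λ t → sub (s ∙ t)))
        ; top   = λ all → Φ.top (λ s → ψ.top (λ t → all (s ∙ t)))
        ; point = λ p → let (s , q) = Φ.point p ; (t , a) = ψ.point q in s ∙ t , a
        }
      -- The analogue of `C ∙ q ∙ C ∙ q` lying in `C ∙ q`: additivity of `φ` inserts a factor before
      -- the last one, `⊑-product` splits the outer variable, and the rest is associativity.
      ; additive = λ {A} p → Φ.up (λ s → ψ.up λ t → Φ.up λ s′ → ψ.up λ t′ →
          subst (T ∘ A) (trans (cong (_∙ t′) (assoc s t s′)) (trans (assoc s (t ∙ s′) t′)
            (trans (cong (s ∙_) (assoc t s′ t′)) (sym (assoc s t (s′ ∙ t′)))))))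
          (⊑-product {λ t → φ (λ s → ψ (λ t′ → A ((t ∙ s) ∙ t′)))} (Φ.additive p))
      }

  -- P meets every closed subsemigroup contained in that of Φ.
  Large : AdditiveFilter → (ℕ → Set) → Set
  Large Φ P = (Ψ : AdditiveFilter) → family Φ ⊑ family Ψ → ¬ T (family Ψ ⟦ (λ x → ¬ P x) ⟧)

  Large-mono : ∀ {Φ Ψ} {P Q : ℕ → Set} → family Φ ⊑ family Ψ → (∀ x → P x → Q x) →
    Large Φ P → Large Ψ Q
  Large-mono Φ⊑Ψ P⊆Q large Ξ Ψ⊑Ξ p =
    large Ξ (λ a → Ψ⊑Ξ (Φ⊑Ψ a)) (up Ξ (λ x ¬q → tick (λ p → untick ¬q (P⊆Q x p))) p)

  -- Either the last colour class is large, or an additive extension contains its complement, and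
  -- over this extension the remaining colours suffice.
  Large-colour : ∀ Φ {P} (col : ℕ → ℕ) r → (∀ x → P x → col x < r) → Large Φ P →
    ∃ λ i → ∃ λ Ψ → family Φ ⊑ family Ψ × Large Ψ (λ x → P x × col x ≡ i)
  Large-colour Φ col zero bound large =
    ⊥-elim (large Φ id (top Φ (λ x → tick (λ p → n≮0 (bound x p)))))
  Large-colour Φ {P} col (suc r) bound large with em {Large Φ (λ x → P x × col x ≡ r)}
  ... | yes largeᵣ = r , Φ , id , largeᵣ
  ... | no ¬largeᵣ with dne {∃ λ Ψ → family Φ ⊑ family Ψ × T (family Ψ ⟦ (λ x → ¬ (P x × col x ≡ r)) ⟧)}
                            (λ none → ¬largeᵣ λ Ψ Φ⊑Ψ p → none (Ψ , Φ⊑Ψ , p))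
  ...   | Ψ , Φ⊑Ψ , small with Large-colour Ψ {λ x → P x × col x ≢ r} col r
            (λ { x (p , ≢r) → ≤∧≢⇒< (≤-pred (bound x p)) ≢r })
            (λ Ξ Ψ⊑Ξ q → large Ξ (λ a → Ψ⊑Ξ (Φ⊑Ψ a))
              (meet Ξ (λ x ¬a ¬b → tick (λ p → untick ¬b (p , λ eq → untick ¬a (p , eq)))) (Ψ⊑Ξ small) q))
  ...     | i , Ψ′ , Ψ⊑Ψ′ , large′ =
    i , Ψ′ , (λ a → Ψ⊑Ψ′ (Φ⊑Ψ a)) , Large-mono {Ψ′} {Ψ′} id (λ { x ((p , _) , eq) → p , eq }) large′

  -- The Ellis argument for countably many sets

  module HomogeneousFilter (Φ₀ : AdditiveFilter) (col : ℕ → ℕ) (r : ℕ) (bound : ∀ x → col x < r) where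

    record Stage : Set₁ where
      field
        filter : AdditiveFilter
        extends : family Φ₀ ⊑ family filter
        piece  : ℕ → Set
        large  : Large filter piece
    open Stage

    refine : ∀ n (S : Stage) → ∃ λ i → ∃ λ Ψ → family (filter S) ⊑ family Ψ ×
      Large Ψ (λ t → piece S t × col (n ∙ t) ≡ i)
    refine n S = Large-colour (filter S) (λ t → col (n ∙ t)) r (λ t _ → bound (n ∙ t)) (large S)

    stage : ℕ → Stage
    stage zero = record
      { filter = Φ₀ ; extends = id ; piece = λ _ → ⊤
      ; large = λ Ψ _ p → untick (proj₂ (point Ψ p)) tt }
    stage (suc n) = record
      { filter  = proj₁ (proj₂ next)
      ; extends = λ a → proj₁ (proj₂ (proj₂ next)) (extends (stage n) a)
      ; piece   = λ t → piece (stage n) t × col (n ∙ t) ≡ proj₁ next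
      ; large   = proj₂ (proj₂ (proj₂ next))
      }
      where next = refine n (stage n)

    c : ℕ → ℕ
    c n = proj₁ (refine n (stage n))

    fam : ℕ → Family
    fam n = family (filter (stage n))

    fam-mono′ : ∀ m k → fam m ⊑ fam (k + m)
    fam-mono′ m zero    a = a
    fam-mono′ m (suc k) a = proj₁ (proj₂ (proj₂ (refine (k + m) (stage (k + m))))) (fam-mono′ m k a)

    fam-mono : ∀ {m n} → m ≤ n → fam m ⊑ fam n
    fam-mono {m} {n} m≤n {A} a = subst (λ k → T (fam k A)) (m∸n+n≡m m≤n) (fam-mono′ m (n ∸ m) a)

    -- The sequence c is a limit of translates of col: P n says that translation by t
    -- turns col into c on [0, n), and Q n that translation by u fixes c on [0, n).
    P : ℕ → ℕ → Set
    P n t = ∀ s → s < n → col (s ∙ t) ≡ c s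

    Q : ℕ → ℕ → Set
    Q n u = ∀ s → s < n → c (s ∙ u) ≡ c s

    piece⊆P : ∀ n t → piece (stage n) t → P n t
    piece⊆P (suc n) t (p , eq) s s<1+n with m<1+n⇒m<n∨m≡n s<1+n
    ... | inj₁ s<n  = piece⊆P n t p s s<n
    ... | inj₂ refl = eq

    -- The union of the chain extends every stage, so all the sets `P n` are large over this single
    -- filter.
    limit : AdditiveFilter
    limit = record
      { family   = λ A → ⌊ (∃ λ n → T (fam n A)) ⌋
      ; isFilter = record
        { meet  = λ sub a b → meet′ sub (untick a) (untick b)
        ; top   = λ all → tick (0 , top (filter (stage 0)) all)
        ; point = λ a → let (n , b) = untick a in point (filter (stage n)) b
        }
      ; additive = λ a → additive′ (untick a)
      }
      where
      meet′ : ∀ {A B C} → (∀ x → T (A x) → T (B x) → T (C x)) →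
        (∃ λ n → T (fam n A)) → (∃ λ n → T (fam n B)) → T ⌊ (∃ λ n → T (fam n C)) ⌋
      meet′ sub (m , a) (n , b) = tick (m ⊔ n , meet (filter (stage (m ⊔ n))) sub
        (fam-mono (m≤m⊔n m n) a) (fam-mono (m≤n⊔m m n) b))

      additive′ : ∀ {A} → (∃ λ n → T (fam n A)) →
        T ⌊ (∃ λ n → T (fam n (λ s → ⌊ (∃ λ m → T (fam m (λ t → A (s ∙ t)))) ⌋))) ⌋
      additive′ (n , a) = tick (n ,
        up (filter (stage n)) (λ s b → tick (n , b)) (additive (filter (stage n)) a))

    P-large : ∀ n → Large limit (P n)
    P-large n = Large-mono {filter (stage n)} {limit} (λ a → tick (n , a)) (piece⊆P n) (large (stage n))

    P-dec : Decreasing P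
    P-dec m≤n p s s<m = p s (<-≤-trans s<m m≤n)

    Q-dec : Decreasing Q
    Q-dec m≤n q s s<m = q s (<-≤-trans s<m m≤n)

    compatible : ∀ {Φ} (Q : ℕ → Set) → Large Φ Q → ∀ {B} → T (family Φ B) → ∃ λ x → T (B x) × Q x
    compatible {Φ} Q large b = dne λ none →
      large Φ id (up Φ (λ x inB → tick (λ q → none (x , inB , q))) b)

    -- This filter, not claimed to be additive, takes the place of the point `q` in a product
    -- `C ∙ q`.
    module ψ = Join (isFilter limit) P P-dec (λ n → compatible {limit} (P n) (P-large n))

    -- Otherwise the complement of P n belongs to the additive filter limit ∗ (limit ∨ P).
    Q-compatible : ∀ n {B} → T (family limit B) → ∃ λ u → T (B u) × Q n u
    Q-compatible n {B} b = dne λ none → P-large n (Product.productFilter limit ψ.join-isFilter ψ.⊑-join)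
      (Product.⊑-product limit ψ.join-isFilter ψ.⊑-join)
      (up limit (λ u inB → escape u λ q → none (u , inB , q)) b)
      where
      escape : ∀ u → ¬ Q n u → T ((family limit ∨ P) (λ t → ⟦ (λ x → ¬ P n x) ⟧ (u ∙ t)))
      escape u ¬q with dne {∃ λ s → s < n × c (s ∙ u) ≢ c s}
                        (λ none → ¬q λ s s<n → dne λ ≢ → none (s , s<n , ≢))
      -- For `t` in `P (suc (s ∙ u))` the colour of `s ∙ (u ∙ t)` is `c (s ∙ u)`, which differs from
      -- `c s`; so `u ∙ t` is outside `P n`.
      ... | s , s<n , ≢ = ψ.base (suc (s ∙ u)) λ t p → tick λ p′ →
        ≢ (trans (sym (p (s ∙ u) (n<1+n _))) (trans (cong col (assoc s u t)) (p′ s s<n)))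

    bounded : ∀ (f : ℕ → ℕ) n → ∃ λ m → ∀ s → s < n → f s < m
    bounded f zero = 0 , λ _ ()
    bounded f (suc n) with bounded f n
    ... | m , below = m ⊔ suc (f n) , λ s s<1+n → bound′ s (m<1+n⇒m<n∨m≡n s<1+n)
      where
      bound′ : ∀ s → s < n ⊎ s ≡ n → f s < m ⊔ suc (f n)
      bound′ s (inj₁ s<n)  = <-≤-trans (below s s<n) (m≤m⊔n m _)
      bound′ s (inj₂ refl) = m≤n⊔m m _

    module φ₂ = Join (isFilter limit) Q Q-dec Q-compatible

    -- Additive because `u ∙ v` is in `Q n` whenever `u` is in `Q n` and `v` in `Q m`, with `m`
    -- above all `s ∙ u` for `s < n`.
    Φ₂ : AdditiveFilter
    Φ₂ = record
      { family   = family limit ∨ Q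
      ; isFilter = φ₂.join-isFilter
      ; additive = φ₂.join-isAdditive (additive limit) λ n → φ₂.base n λ u q →
          let (m , below) = bounded (_∙ u) n in
          tick (φ₂.base m λ v q′ → tick λ s s<n →
            trans (cong c (sym (assoc s u v))) (trans (q′ (s ∙ u) (below s s<n)) (q s s<n)))
      }

    P-large₂ : ∀ n → Large Φ₂ (P n)
    P-large₂ n = Large-mono {limit} {Φ₂} φ₂.⊑-join (λ _ → id) (P-large n)

    module θ = Join (isFilter Φ₂) P P-dec (λ n → compatible {Φ₂} (P n) (P-large₂ n))

    -- For additivity the outer variable `u` runs through `Q n`, a member already: translation by
    -- such `u` carries some `P m` into `P n`.
    Θ : AdditiveFilter
    Θ = record
      { family   = family Φ₂ ∨ P
      ; isFilter = θ.join-isFilter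
      ; additive = θ.join-isAdditive (additive Φ₂) λ n → θ.⊑-join (φ₂.base n λ u q →
          let (m , below) = bounded (_∙ u) n in
          tick (θ.base m λ t p → tick λ s s<n →
            trans (cong col (sym (assoc s u t))) (trans (p (s ∙ u) (below s s<n)) (q s s<n))))
      }

    Θ-extends : family Φ₀ ⊑ family Θ
    Θ-extends a = θ.⊑-join (φ₂.⊑-join (tick (0 , a)))

    Θ-homogeneous : T (family Θ ⟦ (λ x → col x ≡ c ε) ⟧)
    -- The level `suc ε` is the first whose condition includes `s = ε`, where it concerns the colour
    -- of `x` itself.
    Θ-homogeneous = θ.base (suc ε) λ x p →
      tick (trans (cong col (sym (identityˡ x))) (p ε (n<1+n ε)))

  -- J-sets

  -- σ m f sums f over the finite set with characteristic sequence m.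
  σ : List Bool → (ℕ → ℕ) → ℕ
  σ []          f = ε
  σ (true ∷ m)  f = f 0 ∙ σ m (f ∘ suc)
  σ (false ∷ m) f = σ m (f ∘ suc)

  Nonempty : List Bool → Set
  Nonempty = LAny.Any (_≡ true)

  block : ∀ {k n} → Vec (Fin k) n → (Fin k → ℕ → ℕ) → ℕ
  block []      f = ε
  block (y ∷ w) f = f y 0 ∙ block w (λ y t → f y (suc t))

  -- The t-th block sums f over the interval [nt, nt + n), the word choosing
  -- which of the sequences f contributes at each position.
  blocks : ∀ {k n} → Vec (Fin k) n → (Fin k → ℕ → ℕ) → ℕ → ℕ
  blocks         w f zero    = block w f
  blocks {n = n} w f (suc t) = blocks w (λ y u → f y (n + u)) t

  -- Fixed letters go into the constant `c`. The set `m′` consists of the variable positions,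
  -- followed by `m` shifted past the word, and does not depend on `x`.
  block-line : ∀ {k n} (ℓ : Line k n) (f : Fin k → ℕ → ℕ) m →
    ∃ λ c → ∃ λ m′ → (Wild ℓ ⊎ Nonempty m → Nonempty m′) ×
      (∀ x → block (ℓ · x) f ∙ σ m (λ u → f x (n + u)) ≡ c ∙ σ m′ (f x))
  block-line [] f m = ε , m , (λ { (inj₂ p) → p }) , λ x → refl
  block-line (just y ∷ ℓ) f m with block-line ℓ (λ y t → f y (suc t)) m
  ... | c , m′ , ne , eq =
    f y 0 ∙ c , false ∷ m′ , (λ { (inj₁ (there p)) → there (ne (inj₁ p)) ; (inj₂ p) → there (ne (inj₂ p)) }) ,
    λ x → trans (assoc _ _ _) (trans (cong (f y 0 ∙_) (eq x)) (sym (assoc _ _ _)))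
  block-line (nothing ∷ ℓ) f m with block-line ℓ (λ y t → f y (suc t)) m
  ... | c , m′ , ne , eq =
    c , true ∷ m′ , (λ _ → here refl) ,
    λ x → trans (assoc _ _ _) (trans (cong (f x 0 ∙_) (eq x)) (swapˡ _ _ _))

  pad : ∀ n m f → σ (List.replicate n false List.++ m) f ≡ σ m (λ u → f (n + u))
  pad zero    m f = refl
  pad (suc n) m f = pad n m (f ∘ suc)

  pad-nonempty : ∀ n {m} → Nonempty m → Nonempty (List.replicate n false List.++ m)
  pad-nonempty zero    p = p
  pad-nonempty (suc n) p = there (pad-nonempty n p)

  -- Along a line, sums of blocks are a translate of sums of one sequence at a time, over a common
  -- index set. This turns witnesses for words into witnesses for the original sequences.
  blocks-line : ∀ {k n} (ℓ : Line k n) → Wild ℓ → ∀ m (f : Fin k → ℕ → ℕ) →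
    ∃ λ c → ∃ λ m′ → (Nonempty m → Nonempty m′) ×
      (∀ x → σ m (blocks (ℓ · x) f) ≡ c ∙ σ m′ (f x))
  blocks-line ℓ wild [] f = ε , [] , (λ ()) , λ x → sym (identityˡ ε)
  blocks-line {n = n} ℓ wild (false ∷ m) f with blocks-line ℓ wild m (λ y u → f y (n + u))
  ... | c , m′ , ne , eq =
    c , _ , (λ { (there p) → pad-nonempty n (ne p) }) ,
    λ x → trans (eq x) (cong (c ∙_) (sym (pad n m′ (f x))))
  blocks-line {n = n} ℓ wild (true ∷ m) f with blocks-line ℓ wild m (λ y u → f y (n + u))
  ... | c , m′ , _ , eq with block-line ℓ f m′
  ...   | c′ , m″ , ne , eq′ =
    c ∙ c′ , m″ , (λ _ → ne (inj₁ wild)) ,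
    λ x → trans (cong (block (ℓ · x) f ∙_) (eq x))
         (trans (swapˡ _ _ _) (trans (cong (c ∙_) (eq′ x)) (sym (assoc _ _ _))))

  σ-∙ : ∀ m f g → σ m (λ t → f t ∙ g t) ≡ σ m f ∙ σ m g
  σ-∙ []          f g = sym (identityˡ ε)
  σ-∙ (false ∷ m) f g = σ-∙ m (f ∘ suc) (g ∘ suc)
  σ-∙ (true ∷ m)  f g =
    trans (cong ((f 0 ∙ g 0) ∙_) (σ-∙ m (f ∘ suc) (g ∘ suc)))
    (trans (assoc _ _ _) (trans (cong (f 0 ∙_) (swapˡ _ _ _)) (sym (assoc _ _ _))))

  ⋆-ε : ∀ a → a ⋆ ε ≡ ε
  ⋆-ε zero    = refl
  ⋆-ε (suc a) = trans (identityˡ _) (⋆-ε a)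

  σ-ε : ∀ m → σ m (λ _ → ε) ≡ ε
  σ-ε []          = refl
  σ-ε (false ∷ m) = σ-ε m
  σ-ε (true ∷ m)  = trans (identityˡ _) (σ-ε m)

  σ-⋆ : ∀ m a f → σ m (λ t → a ⋆ f t) ≡ a ⋆ σ m f
  σ-⋆ []          a f = sym (⋆-ε a)
  σ-⋆ (false ∷ m) a f = σ-⋆ m a (f ∘ suc)
  σ-⋆ (true ∷ m)  a f = trans (cong ((a ⋆ f 0) ∙_) (σ-⋆ m a (f ∘ suc))) (sym (×-distrib-+ _ _ a))

  dot : ∀ {v} → Vec ℕ v → (Fin v → ℕ) → ℕ
  dot []      x = ε
  dot (a ∷ c) x = (a ⋆ x zero) ∙ dot c (x ∘ suc)

  σ-dot : ∀ {v} m (c : Vec ℕ v) (X : ℕ → Fin v → ℕ) →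
    σ m (λ t → dot c (X t)) ≡ dot c (λ k → σ m (λ t → X t k))
  σ-dot m []      X = σ-ε m
  σ-dot m (a ∷ c) X = trans (σ-∙ m _ _)
    (cong₂ _∙_ (σ-⋆ m a _) (σ-dot m c (λ t k → X t (suc k))))

  -- Pick vals n b s: s is a sum of elements of vals m for m in a finite set of indices
  -- m ≥ n, and b tells whether this set is nonempty.
  data Pick (vals : ℕ → List ℕ) : ℕ → Bool → ℕ → Set where
    nil  : ∀ {n} → Pick vals n false ε
    skip : ∀ {n b s} → Pick vals (suc n) b s → Pick vals n b s
    take : ∀ {n b u s} → u ∈ˡ vals n → Pick vals (suc n) b s → Pick vals n true (u ∙ s)

  empty-sum : ∀ {vals n s} → Pick vals n false s → s ≡ ε
  empty-sum nil         = refl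
  empty-sum (skip pick) = empty-sum pick

  σ-pick : ∀ {vals n} m g → (∀ t → g t ∈ˡ vals (n + t)) →
    ∃ λ b → Pick vals n b (σ m g) × (Nonempty m → b ≡ true)
  σ-pick []          g in-vals = false , nil , λ ()
  σ-pick {vals} {n} (bit ∷ m) g in-vals
    with σ-pick {vals} {suc n} m (g ∘ suc) (λ t → subst (λ k → g (suc t) ∈ˡ vals k) (+-suc n t) (in-vals (suc t)))
  σ-pick {vals} {n} (false ∷ m) g in-vals | b , pick , eq = b , skip pick , λ { (there p) → eq p }
  σ-pick {vals} {n} (true ∷ m)  g in-vals | b , pick , eq =
    true , take (subst (λ k → g 0 ∈ˡ vals k) (+-identityʳ n) (in-vals 0)) pick , λ _ → refl

  -- Hindman's construction: shrinking the given member step by step keeps the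
  -- translates by all the values chosen so far inside it.
  module FiniteSums (Θ : AdditiveFilter) (Obj : ℕ → Set) (val : ∀ n → Obj n → List ℕ)
    (rich : ∀ n {A} → T (family Θ A) → ∃ λ o → ∀ {u} → u ∈ˡ val n o → T (A u)) where

    Member : Set
    Member = ∃ λ A → T (family Θ A)

    translates : ∀ (A : Subset) L → (∀ u → u ∈ˡ L → T (family Θ (λ t → A (u ∙ t)))) →
      T (family Θ ⟦ (λ t → ∀ u → u ∈ˡ L → T (A (u ∙ t))) ⟧)
    translates A []      all = top Θ λ t → tick λ _ ()
    translates A (u ∷ L) all = meet Θ
      (λ t p q → tick λ { _ (here refl) → p ; v (there r) → untick q v r })
      (all u (here refl)) (translates A L λ v v∈ → all v (there v∈))

    -- By additivity the elements of `A` that translate a member into `A` form a member themselves,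
    -- to which `rich` applies.
    choose : ∀ n ((A , p) : Member) →
      ∃ λ o → ∀ u → u ∈ˡ val n o → T (A u) × T (family Θ (λ t → A (u ∙ t)))
    choose n (A , p) with rich n {⟦ (λ u → T (A u) × T (family Θ (λ t → A (u ∙ t)))) ⟧}
                           (meet Θ (λ _ a b → tick (a , b)) p (additive Θ p))
    ... | o , in-kernel = o , λ u u∈ → untick (in-kernel u∈)

    shrink : ℕ → Member → Member
    shrink n (A , p) = ⟦ (λ t → T (A t) × (∀ u → u ∈ˡ val n o → T (A (u ∙ t)))) ⟧ ,
      meet Θ (λ t a b → tick (a , untick b)) p (translates A (val n o) (λ u u∈ → proj₂ (in-kernel u u∈)))
      where
      o = proj₁ (choose n (A , p))
      in-kernel = proj₂ (choose n (A , p))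

    module From {A : Subset} (A∈Θ : T (family Θ A)) where

      member : ℕ → Member
      member zero    = A , A∈Θ
      member (suc n) = shrink n (member n)

      object : ∀ n → Obj n
      object n = proj₁ (choose n (member n))

      -- The tail of the sum lies in `member (suc n)`, hence in `member n`, also after translation
      -- by any value of `object n`.
      sums : ∀ {n s} → Pick (λ n → val n (object n)) n true s → T (proj₁ (member n) s)
      sums {n} (skip pick) = proj₁ (untick (sums pick))
      sums {n} (take {b = true} u∈ pick) = proj₂ (untick (sums pick)) _ u∈
      sums {n} (take {b = false} {u} u∈ pick) =
        subst (T ∘ proj₁ (member n)) (trans (sym (identityʳ u)) (cong (u ∙_) (sym (empty-sum pick))))
          (proj₁ (proj₂ (choose n (member n)) _ u∈))

  -- The additive filter of J-sets relative to a thick set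

  module Thick (U : ℕ → Set)
    (thick : (F : List ℕ) → ∃ λ a → ∀ {u} → u ∈ˡ F → U (a ∙ u)) where

    -- Big A says that A is a J-set, with the points found so that their translates by
    -- any given finite set also lie in U.
    Witness : (ℕ → Set) → ∀ {k} → (Fin (suc k) → ℕ → ℕ) → List ℕ → Set
    Witness A f G = ∃ λ a → ∃ λ m → Nonempty m × (∀ i → A (a ∙ σ m (f i))) ×
      (∀ i {g} → g ∈ˡ G → U (g ∙ (a ∙ σ m (f i))))

    record Big (A : ℕ → Set) : Set where
      constructor mkBig
      field
        witness : ∀ {k} (f : Fin (suc k) → ℕ → ℕ) G → Witness A f G
    open Big

    Big-mono : ∀ {A B : ℕ → Set} → (∀ x → A x → B x) → Big A → Big B
    Big-mono A⊆B big .witness f G with witness big f G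
    ... | a , m , ne , inA , inU = a , m , ne , (λ i → A⊆B _ (inA i)) , inU

    -- Thickness enters here: for the index set consisting of 0 only, finitely many points have to
    -- be moved into `U`.
    Big-all : Big (λ _ → ⊤)
    Big-all .witness {k} f G with thick (cartesianProductWith (λ g i → g ∙ σ (true ∷ []) (f i)) G (allFin (suc k)))
    ... | a , inU = a , true ∷ [] , here refl , (λ _ → tt) ,
      λ i {g} g∈G → subst U (swapˡ a g _)
        (inU (∈-cartesianProductWith⁺ (λ g i → g ∙ σ (true ∷ []) (f i)) g∈G (∈-allFin i)))

    Big-point : ∀ {A} → Big A → ∃ A
    Big-point big with witness big {0} (λ _ _ → ε) []
    ... | a , m , _ , inA , _ = _ , inA zero

    -- The set `G` in `Witness` serves this purpose: replacing `a` by `s ∙ a` is compensated by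
    -- requesting the translates `g ∙ s` beforehand.
    Big-translate : ∀ {A : ℕ → Set} s → Big (λ t → A (s ∙ t)) → Big A
    Big-translate {A} s big .witness f G with witness big f (List.map (_∙ s) G)
    ... | a , m , ne , inA , inU =
      s ∙ a , m , ne , (λ i → subst A (sym (assoc _ _ _)) (inA i)) ,
      λ i {g} g∈G → subst U (trans (assoc g s _) (cong (g ∙_) (sym (assoc s a _))))
                            (inU i (∈-map⁺ (_∙ s) g∈G))

    -- Hales–Jewett is applied to the words over the disjoint union of both families,
    -- each word acting as one sequence.
    Big-∪-witness : ∀ {A B : ℕ → Set} → Big (λ x → A x ⊎ B x) →
      ∀ {k} (f : Fin (suc k) → ℕ → ℕ) G {k′} (f′ : Fin (suc k′) → ℕ → ℕ) G′ →
      Witness A f G ⊎ Witness B f′ G′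
    Big-∪-witness {A} {B} big {k} f G {k′} f′ G′ = split (em {A (value (ℓ · zero))})
      where
      h : Fin (suc k + suc k′) → ℕ → ℕ
      h = Sum.[ f , f′ ] ∘ splitAt (suc k)

      hj = halesJewett (k + suc k′) Bool (true ∷ false ∷ [])
      n = proj₁ hj
      ws = words (suc k + suc k′) n

      -- The extra word in front of `ws` only makes the index set visibly nonempty.
      found = witness big {length ws} (λ i → blocks (List.lookup (Vec.replicate n zero ∷ ws) i) h) (G List.++ G′)
      a = proj₁ found
      m = proj₁ (proj₂ found)

      value : Vec (Fin (suc k + suc k′)) n → ℕ
      value w = a ∙ σ m (blocks w h)

      position : ∀ w → ∃ λ i → w ≡ List.lookup (Vec.replicate n zero ∷ ws) i
      position w = suc (index (∈-words w)) , lookup-index (∈-words w)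

      value-AB : ∀ w → A (value w) ⊎ B (value w)
      value-AB w with position w
      ... | i , refl = proj₁ (proj₂ (proj₂ (proj₂ found))) i

      value-U : ∀ w {g} → g ∈ˡ G List.++ G′ → U (g ∙ value w)
      value-U w with position w
      ... | i , refl = proj₂ (proj₂ (proj₂ (proj₂ found))) i

      Bool∈ : ∀ b → b ∈ˡ true ∷ false ∷ []
      Bool∈ true  = here refl
      Bool∈ false = there (here refl)

      line = proj₂ hj (λ w → ⌊ A (value w) ⌋) (λ w → Bool∈ _)
      ℓ = proj₁ line

      along : ∀ x y → A (value (ℓ · x)) → A (value (ℓ · y))
      along x y p = untick (subst T (trans (proj₂ (proj₂ line) x) (sym (proj₂ (proj₂ line) y))) (tick p))

      sub = blocks-line ℓ (proj₁ (proj₂ line)) m h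
      c = proj₁ sub
      m′ = proj₁ (proj₂ sub)
      m′-nonempty = proj₁ (proj₂ (proj₂ sub)) (proj₁ (proj₂ (proj₂ found)))

      value-line : ∀ x {φ} → h x ≡ φ → value (ℓ · x) ≡ (a ∙ c) ∙ σ m′ φ
      value-line x refl = trans (cong (a ∙_) (proj₂ (proj₂ (proj₂ sub)) x)) (sym (assoc _ _ _))

      left : ∀ i → value (ℓ · (i ↑ˡ suc k′)) ≡ (a ∙ c) ∙ σ m′ (f i)
      left i = value-line _ (cong Sum.[ f , f′ ] (splitAt-↑ˡ (suc k) i (suc k′)))

      right : ∀ i → value (ℓ · (suc k ↑ʳ i)) ≡ (a ∙ c) ∙ σ m′ (f′ i)
      right i = value-line _ (cong Sum.[ f , f′ ] (splitAt-↑ʳ (suc k) (suc k′) i))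

      split : Dec (A (value (ℓ · zero))) → Witness A f G ⊎ Witness B f′ G′
      -- The line is monochromatic: if `A` holds once it holds at the letters of `f`; otherwise it
      -- fails throughout, so `B` holds at the letters of `f′`.
      split (yes p) = inj₁ (a ∙ c , m′ , m′-nonempty ,
        (λ i → subst A (left i) (along zero _ p)) ,
        λ i {g} g∈G → subst (λ z → U (g ∙ z)) (left i) (value-U _ (∈-++⁺ˡ g∈G)))
      split (no ¬p) = inj₂ (a ∙ c , m′ , m′-nonempty ,
        (λ i → subst B (right i)
          (fromInj₂ (λ q → ⊥-elim (¬p (along (suc k ↑ʳ i) zero q))) (value-AB (ℓ · (suc k ↑ʳ i))))) ,
        λ i {g} g∈G → subst (λ z → U (g ∙ z)) (right i) (value-U _ (∈-++⁺ʳ G g∈G)))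

    -- If both sets failed, they could fail at different families; hence the preceding lemma treats
    -- two families at once.
    Big-∪ : ∀ {A B : ℕ → Set} → Big (λ x → A x ⊎ B x) → Big A ⊎ Big B
    Big-∪ {A} {B} big with em {Big A}
    ... | yes bigA = inj₁ bigA
    ... | no ¬bigA = inj₂ (mkBig λ f′ G′ → dne λ ¬w →
      ¬bigA (mkBig λ f G → Sum.[ id , (λ w → ⊥-elim (¬w w)) ] (Big-∪-witness {A} {B} big f G f′ G′)))

    bigFilter : AdditiveFilter
    bigFilter = record
      { family   = λ A → ⌊ ¬ Big (λ x → ¬ T (A x)) ⌋
      ; isFilter = record
        { meet  = λ {A} {B} {C} → meet′ {A} {B} {C}
        ; top   = λ all → tick λ big → let (x , ¬a) = Big-point big in ¬a (all x)
        ; point = λ p → dne λ none → untick p (Big-mono (λ x _ a → none (x , a)) Big-all)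
        }
      ; additive = additive′
      }
      where
      -- A single `s` whose translate of `A` is not in the family would, by `Big-translate`, make
      -- the complement of `A` `Big`.
      additive′ : IsAdditive (λ A → ⌊ ¬ Big (λ x → ¬ T (A x)) ⌋)
      additive′ {A} p = tick λ big → let (s , ¬a) = Big-point big in
        ¬a (tick λ big′ → untick p (Big-translate {λ x → ¬ T (A x)} s big′))

      meet′ : ∀ {A B C : Subset} → (∀ x → T (A x) → T (B x) → T (C x)) →
        T ⌊ ¬ Big (λ x → ¬ T (A x)) ⌋ → T ⌊ ¬ Big (λ x → ¬ T (B x)) ⌋ → T ⌊ ¬ Big (λ x → ¬ T (C x)) ⌋
      meet′ {A} {B} {C} sub p q = tick λ big →
        Sum.[ untick p , untick q ]
          (Big-∪ {λ x → ¬ T (A x)} {λ x → ¬ T (B x)} (Big-mono (λ x ¬c → cover x ¬c em) big))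
        where
        cover : ∀ x → ¬ T (C x) → Dec (T (A x)) → ¬ T (A x) ⊎ ¬ T (B x)
        cover x ¬c (yes a) = inj₂ λ b → ¬c (sub x a b)
        cover x ¬c (no ¬a) = inj₁ ¬a

    module Extension (Θ : AdditiveFilter) (extends : family bigFilter ⊑ family Θ) where

      -- Otherwise the complement of `A` would lie in `bigFilter`, hence in `Θ` beside `A`.
      member-big : ∀ {A} → T (family Θ A) → Big (λ x → T (A x))
      member-big {A} p = dne λ ¬big →
        let (x , ¬a) = point Θ {⟦ (λ _ → ⊥) ⟧} (meet Θ (λ x a b → ⊥-elim (untick b a)) p
                         (extends (tick λ big → ¬big (Big-mono (λ x b → dne λ ¬a → b (tick ¬a)) big))))
        in untick {⊥} ¬a

      U-member : T (family Θ ⟦ U ⟧)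
      -- With `ε` as the only element of `G`, a witness for the complement of `U` would be a point
      -- of `U`.
      U-member = extends (tick λ big → let (a , m , _ , ¬u , u) = witness big {0} (λ _ _ → ε) (ε ∷ []) in
        ¬u zero (tick (subst U (identityˡ _) (u zero (here refl)))))

      -- Induction on the columns. Images for the later columns form a sequence `object` with all
      -- finite sums in `A`. As `A` is a J-set, one `a` and one `m` serve all coefficient vectors:
      -- `a` is the new first entry, and summing over `m` gives the others. Rows beginning with 0
      -- are covered by the finite sums.
      rowImage : ∀ K v {A} → T (family Θ A) →
        ∃ λ (x : Fin v → ℕ) → ∀ {ρ} → ρ ∈ˡ rows K v → T (A (dot ρ x))
      rowImage K zero    A∈Θ = (λ ()) , λ ()
      rowImage K (suc v) {A} A∈Θ = a ∷ᶠ y , image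
        where
        values : (Fin v → ℕ) → List ℕ
        values x = List.map (λ ρ → dot ρ x) (rows K v)

        rich : ∀ (n : ℕ) {A} → T (family Θ A) → ∃ λ x → ∀ {u} → u ∈ˡ values x → T (A u)
        rich _ {A} p with rowImage K v {A} p
        ... | x , im = x , λ u∈ → let (ρ , ρ∈ , eq) = ∈-map⁻ (λ ρ → dot ρ x) u∈ in
          subst (T ∘ A) (sym eq) (im ρ∈)

        open FiniteSums.From Θ (λ _ → Fin v → ℕ) (λ _ → values) rich {A} A∈Θ

        cs = coefs K v
        found = witness (member-big A∈Θ) {length cs}
          (λ i t → dot (List.lookup (Vec.replicate v 0 ∷ cs) i) (object t)) []
        a = proj₁ found
        m = proj₁ (proj₂ found)
        y : Fin v → ℕ
        y k = σ m (λ t → object t k)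

        image-coef : ∀ {ρ} → ρ ∈ˡ cs → T (A (a ∙ dot ρ y))
        image-coef {ρ} ρ∈ = subst (T ∘ A)
          (cong (a ∙_) (trans (cong (λ ρ → σ m (λ t → dot ρ (object t))) (sym (lookup-index ρ∈)))
                              (σ-dot m ρ object)))
          (proj₁ (proj₂ (proj₂ (proj₂ found))) (suc (index ρ∈)))

        image-row : ∀ {ρ} → ρ ∈ˡ rows K v → T (A (dot ρ y))
        image-row {ρ} ρ∈
          with σ-pick {n = 0} m (λ t → dot ρ (object t)) (λ t → ∈-map⁺ (λ ρ → dot ρ (object t)) ρ∈)
        ... | b , pick , nonempty with nonempty (proj₁ (proj₂ (proj₂ found)))
        ...   | refl = subst (T ∘ A) (σ-dot m ρ object) (sums pick)

        image : ∀ {ρ} → ρ ∈ˡ rows K (suc v) → T (A (dot ρ (a ∷ᶠ y)))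
        image ρ∈ with ∈-++⁻ (List.map (1 ∷_) cs) ρ∈
        ... | inj₁ p with ∈-map⁻ (1 ∷_) p
        ...   | ρ , ρ∈′ , refl = subst (λ z → T (A (z ∙ dot ρ y))) (sym (identityʳ a)) (image-coef ρ∈′)
        image ρ∈ | inj₂ p with ∈-map⁻ (0 ∷_) p
        ...   | ρ , ρ∈′ , refl = subst (T ∘ A) (sym (identityˡ _)) (image-row ρ∈′)

    -- `rowImage` handles one segment inside any member of `Θ`; the finite sums construction makes
    -- the choices for different segments compatible.
    segmentedImage : (K v : ℕ → ℕ) (col : ℕ → ℕ) (r : ℕ) → (∀ x → col x < r) →
      ∃ λ c → ∃ λ (x : ∀ n → Fin (v n) → ℕ) → ∀ {s} →
        Pick (λ n → List.map (λ ρ → dot ρ (x n)) (rows (K n) (v n))) 0 true s → U s × col s ≡ c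
    segmentedImage K v col r bound = c ε , object , λ pick → untick (sums pick)
      where
      open HomogeneousFilter bigFilter col r bound
      open Extension Θ Θ-extends

      rich : ∀ n {A} → T (family Θ A) → ∃ λ (x : Fin (v n) → ℕ) →
        ∀ {u} → u ∈ˡ List.map (λ ρ → dot ρ x) (rows (K n) (v n)) → T (A u)
      rich n {A} p with rowImage (K n) (v n) {A} p
      ... | x , im = x , λ u∈ → let (ρ , ρ∈ , eq) = ∈-map⁻ (λ ρ → dot ρ x) u∈ in
        subst (T ∘ A) (sym eq) (im ρ∈)

      open FiniteSums.From Θ (λ n → Fin (v n) → ℕ) _ rich {⟦ (λ x → U x × col x ≡ c ε) ⟧}
        (meet Θ (λ x u eq → tick (untick u , untick eq)) U-member Θ-homogeneous)

  -- Images of segmented matrices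

  Π : (ℕ → ℕ) → ℕ → ℕ
  Π h zero    = ε
  Π h (suc n) = h 0 ∙ Π (h ∘ suc) n

  Π-cong : ∀ {g h} n → (∀ j → g j ≡ h j) → Π g n ≡ Π h n
  Π-cong zero    eq = refl
  Π-cong (suc n) eq = cong₂ _∙_ (eq 0) (Π-cong n (eq ∘ suc))

  Π-ε : ∀ {h} n → (∀ j → h j ≡ ε) → Π h n ≡ ε
  Π-ε zero    eq = refl
  Π-ε (suc n) eq = trans (cong₂ _∙_ (eq 0) (Π-ε n (eq ∘ suc))) (identityˡ ε)

  Π-+ : ∀ h m n → Π h (m + n) ≡ Π h m ∙ Π (λ j → h (m + j)) n
  Π-+ h zero    n = sym (identityˡ _)
  Π-+ h (suc m) n = trans (cong (h 0 ∙_) (Π-+ (h ∘ suc) m n)) (sym (assoc _ _ _))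

  dot-tabulate : ∀ {v} (g y : Fin v → ℕ) h → (∀ k → h (toℕ k) ≡ g k ⋆ y k) →
    dot (tabulate g) y ≡ Π h v
  dot-tabulate {zero}  g y h eq = refl
  dot-tabulate {suc v} g y h eq =
    cong₂ _∙_ (sym (eq zero)) (dot-tabulate (g ∘ suc) (y ∘ suc) (h ∘ suc) (eq ∘ suc))

  dot-zeros : ∀ v (y : Fin v → ℕ) → dot (replicate v 0) y ≡ ε
  dot-zeros zero    y = refl
  dot-zeros (suc v) y = trans (identityˡ _) (dot-zeros v (y ∘ suc))

  zeros∈coefs : ∀ K v → replicate v 0 ∈ˡ coefs K v
  zeros∈coefs K v = ∈-vecs (zeros v)
    where
    zeros : ∀ v → VAll.All (_∈ˡ List.upTo (suc K)) (replicate v 0)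
    zeros zero    = []
    zeros (suc v) = here refl ∷ zeros v

  -- Through the unit vectors the coordinates of the solution are among its images, and so inherit
  -- colour and membership in `U`.
  unit-row : ∀ K {v} (k : Fin v) → ∃ λ ρ → ρ ∈ˡ rows K v × (∀ y → dot ρ y ≡ y k)
  unit-row K {suc v} zero = 1 ∷ replicate v 0 , ∈-++⁺ˡ (∈-map⁺ (1 ∷_) (zeros∈coefs K v)) ,
    λ y → trans (cong₂ _∙_ (identityʳ _) (dot-zeros v _)) (identityʳ _)
  unit-row K {suc v} (suc k) with unit-row K k
  ... | ρ , ρ∈ , eq = 0 ∷ ρ , ∈-++⁺ʳ (List.map (1 ∷_) (coefs K v)) (∈-map⁺ (0 ∷_) ρ∈) ,
    λ y → trans (identityˡ _) (eq (y ∘ suc))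

  single : ∀ {vals} n {u} → u ∈ˡ vals n → Pick vals 0 true u
  single {vals} n {u} u∈ = skips n (subst (Pick vals n true) (identityʳ u) (take u∈ nil))
    where
    skips : ∀ n {b s} → Pick vals n b s → Pick vals 0 b s
    skips zero    p = p
    skips (suc n) p = skips n (skip p)

  module _ {A : ℕ → ℕ → ℕ} (seg : Segmented A) (o : ∀ n → Fin (Segmented.width seg n) → ℕ) where
    open Segmented seg

    private
      x = glue o
      vals : ℕ → List ℕ
      vals n = List.map (λ ρ → dot ρ (o n)) (rows (K n) (width n))

    glue-pick : ∀ j → Pick vals 0 true (x j)
    glue-pick j with locate j
    ... | n , k , _ with unit-row (K n) k
    ...   | ρ , ρ∈ , eq = single n (subst (_∈ˡ vals n) (eq (o n)) (∈-map⁺ (λ ρ → dot ρ (o n)) ρ∈))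

    module _ (i : ℕ) where

      private
        h : ℕ → ℕ
        h j = A i j ⋆ x j

      segment-sum : ∀ n → dot (tabulate (λ (k : Fin (width n)) → A i (α n + toℕ k))) (o n) ≡
        Π (λ j → h (α n + j)) (width n)
      segment-sum n = dot-tabulate _ (o n) _ (λ k → cong (A i (α n + toℕ k) ⋆_) (glue-at o n k))

      -- Induction over `d` consecutive segments: zero segments are skipped, the others taken. The
      -- last clause rules out the empty sum for a nonzero row.
      row-pick : ∀ d n {L} → α n + L ≡ α (d + n) → ∃ λ b →
        Pick vals n b (Π (λ j → h (α n + j)) L) ×
        (b ≡ false → ∀ j → j < L → A i (α n + j) ≡ 0)
      row-pick zero n {L} eq with +-cancelˡ-≡ (α n) L 0 (trans eq (sym (+-identityʳ (α n))))
      ... | refl = false , nil , λ _ _ ()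
      row-pick (suc d) n {L} eq = extend (row-pick d (suc n) L′-eq) (segment-row n i)
        where
        L′ = α (d + suc n) ∸ α (suc n)

        L′-eq : α (suc n) + L′ ≡ α (d + suc n)
        L′-eq = m+[n∸m]≡n (α-mono-+ d (suc n))

        L-eq : L ≡ width n + L′
        L-eq = +-cancelˡ-≡ (α n) _ _ (trans eq (trans (cong α (sym (+-suc d n)))
          (trans (sym L′-eq) (trans (cong (_+ L′) (sym (α+width n))) (+-assoc (α n) (width n) L′)))))

        next : ∀ j → α n + (width n + j) ≡ α (suc n) + j
        next j = trans (sym (+-assoc (α n) (width n) j)) (cong (_+ j) (α+width n))

        split : Π (λ j → h (α n + j)) L ≡
          Π (λ j → h (α n + j)) (width n) ∙ Π (λ j → h (α (suc n) + j)) L′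
        split = trans (cong (Π _) L-eq) (trans (Π-+ _ (width n) L′)
          (cong (Π (λ j → h (α n + j)) (width n) ∙_) (Π-cong L′ (λ j → cong h (next j)))))

        extend : (∃ λ b → Pick vals (suc n) b (Π (λ j → h (α (suc n) + j)) L′) ×
            (b ≡ false → ∀ j → j < L′ → A i (α (suc n) + j) ≡ 0)) →
          (∀ (k : Fin (width n)) → A i (α n + toℕ k) ≡ 0) ⊎
            tabulate (λ (k : Fin (width n)) → A i (α n + toℕ k)) ∈ˡ rows (K n) (width n) →
          ∃ λ b → Pick vals n b (Π (λ j → h (α n + j)) L) ×
            (b ≡ false → ∀ j → j < L → A i (α n + j) ≡ 0)
        extend (b , pick , _) (inj₂ row) =
          true , subst (Pick vals n true) (sym split)
            (take (subst (_∈ˡ vals n) (segment-sum n) (∈-map⁺ (λ ρ → dot ρ (o n)) row)) pick) , λ ()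
        extend (b , pick , zeros) (inj₁ zeroSeg) =
          b , subst (Pick vals n b) (sym (trans split
            (trans (cong (_∙ Π (λ j → h (α (suc n) + j)) L′) seg-ε) (identityˡ _)))) (skip pick) , zeros′
          where
          zero-at : ∀ j → j < width n → A i (α n + j) ≡ 0
          zero-at j j<w = trans (cong (λ k → A i (α n + k)) (sym (toℕ-fromℕ< j<w))) (zeroSeg (fromℕ< j<w))

          dot-zero : ∀ {v} (g y : Fin v → ℕ) → (∀ k → g k ≡ 0) → dot (tabulate g) y ≡ ε
          dot-zero {zero}  g y eq = refl
          dot-zero {suc v} g y eq =
            trans (cong₂ _∙_ (cong (_⋆ y zero) (eq zero)) (dot-zero (g ∘ suc) (y ∘ suc) (eq ∘ suc))) (identityˡ ε)

          seg-ε : Π (λ j → h (α n + j)) (width n) ≡ ε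
          seg-ε = trans (sym (segment-sum n)) (dot-zero _ (o n) zeroSeg)

          zeros′ : b ≡ false → ∀ j → j < L → A i (α n + j) ≡ 0
          zeros′ b≡ j j<L with j <? width n
          ... | yes j<w = zero-at j j<w
          ... | no j≮w = trans (cong (A i) (trans (cong (α n +_) (sym j-eq)) (next (j ∸ width n))))
              (zeros b≡ (j ∸ width n)
                (+-cancelˡ-< (width n) _ _ (subst₂ _<_ (sym j-eq) L-eq j<L)))
            where
            j-eq : width n + (j ∸ width n) ≡ j
            j-eq = m+[n∸m]≡n (≮⇒≥ j≮w)

      row-sum-pick : ∀ N → (∀ j → N ≤ j → A i j ≡ 0) → Pick vals 0 true (Π h N)
      -- As `n ≤ α n`, the first `N` segments reach column `N`; the columns beyond it contribute
      -- `ε`.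
      row-sum-pick N beyond with row-pick N 0 {α N}
        (trans (cong (_+ α N) α-zero) (cong α (sym (+-identityʳ N))))
      ... | b , pick , zeros = conclude b pick zeros
        where
        j₀ = proj₁ (nonzero i)

        j₀<N : j₀ < N
        j₀<N = ≰⇒> λ N≤j → proj₂ (nonzero i) (beyond j₀ N≤j)

        sum-eq : Π (λ j → h (α 0 + j)) (α N) ≡ Π h N
        sum-eq = trans (Π-cong (α N) (λ j → cong (λ a → h (a + j)) α-zero))
          (trans (cong (Π h) (sym (m+[n∸m]≡n (n≤αn N))))
          (trans (Π-+ h N (α N ∸ N))
          (trans (cong (Π h N ∙_) (Π-ε (α N ∸ N) λ j → cong (_⋆ x (N + j)) (beyond (N + j) (m≤m+n N j))))
                 (identityʳ _))))

        conclude : ∀ b → Pick vals 0 b (Π (λ j → h (α 0 + j)) (α N)) →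
          (b ≡ false → ∀ j → j < α N → A i (α 0 + j) ≡ 0) → Pick vals 0 true (Π h N)
        conclude true  pick _ = subst (Pick vals 0 true) sum-eq pick
        conclude false _ zeros = ⊥-elim (proj₂ (nonzero i)
          (trans (cong (λ a → A i (a + j₀)) (sym α-zero)) (zeros refl j₀ (<-≤-trans j₀<N (n≤αn N)))))

  abstract
    matrixImage : ∀ {A} → Segmented A → (U : ℕ → Set) →
      ((F : List ℕ) → ∃ λ a → ∀ {u} → u ∈ˡ F → U (a ∙ u)) →
      (col : ℕ → ℕ) (r : ℕ) → (∀ x → col x < r) →
      ∃ λ c → ∃ λ (x : ℕ → ℕ) → (∀ j → U (x j) × col (x j) ≡ c) ×
        (∀ i N → (∀ j → N ≤ j → A i j ≡ 0) →
          let z = Π (λ j → A i j ⋆ x j) N in U z × col z ≡ c)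
    matrixImage seg U thick col r bound =
      let (c , o , good) = Thick.segmentedImage U thick (Segmented.K seg) (Segmented.width seg) col r bound
      in c , Segmented.glue seg o , (λ j → good (glue-pick seg o j)) ,
         λ i N beyond → good (row-sum-pick seg o i N beyond)

  -- Points outside `U` may get any colour, here that of some point of `U`, because all entries land
  -- in `U`.
  coveredImage : ∀ {A} → Segmented A → (U : ℕ → Set) →
    ((F : List ℕ) → ∃ λ a → ∀ {u} → u ∈ˡ F → U (a ∙ u)) →
    ∀ {r} (E : Fin r → ℕ → Set) → (∀ n → U n → ∃ λ i → E i n) →
    ∃ λ i → ∃ λ (x : ℕ → ℕ) → (∀ j → U (x j)) ×
      (∀ k N → (∀ j → N ≤ j → A k j ≡ 0) → E i (Π (λ j → A k j ⋆ x j) N))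
  coveredImage {A} seg U thick {r} E cover = i , x , (λ j → proj₁ (x-good j)) , λ k N beyond →
      conclude _ (image-good k N beyond)
    where
    some-U : ∃ λ a → U a
    some-U = let (a , u) = thick (0 ∷ []) in a ∙ 0 , u (here refl)

    colour : ∀ n → ∃ λ i → U n → E i n
    colour n with em {U n}
    ... | yes u = let (i , e) = cover n u in i , λ _ → e
    ... | no ¬u = proj₁ (cover (proj₁ some-U) (proj₂ some-U)) , λ u → ⊥-elim (¬u u)

    found = matrixImage seg U thick (λ n → toℕ (proj₁ (colour n))) r (λ n → toℕ<n (proj₁ (colour n)))
    x = proj₁ (proj₂ found)
    -- The colour found is only a number; as `x 0` has it too, the class is read off there.
    i = proj₁ (colour (x 0))
    x-good = proj₁ (proj₂ (proj₂ found))
    image-good = proj₂ (proj₂ (proj₂ found))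

    conclude : ∀ z → U z × toℕ (proj₁ (colour z)) ≡ proj₁ found → E i z
    conclude z (u , eq) = subst (λ i → E i z)
      (toℕ-injective (trans eq (sym (proj₂ (x-good 0))))) (proj₂ (colour z) u)

-- Monic segmented first entries matrices

/1-injective : ∀ {a b} → pos a ℚ./ 1 ≡ pos b ℚ./ 1 → a ≡ b
/1-injective {a} {b} eq with /-injective-≃ (mkℚᵘ (pos a) 0) (mkℚᵘ (pos b) 0) eq
... | *≡* eq′ = ℤ.+-injective (trans (sym (ℤ.*-identityʳ (pos a))) (trans eq′ (ℤ.*-identityʳ (pos b))))

fin-bound : ∀ {n} (f : Fin n → ℕ) → ∃ λ K → ∀ i → f i ≤ K
fin-bound {zero}  f = 0 , λ ()
fin-bound {suc n} f with fin-bound (f ∘ suc)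
... | K , below = f zero ⊔ K , λ where
  zero    → m≤m⊔n (f zero) K
  (suc i) → ≤-trans (below i) (m≤n⊔m (f zero) K)

zero-or-row : ∀ {v K} (g : Fin v → ℕ) → (∀ k → g k ≤ K) →
  (∀ k → g k ≢ 0 → (∀ l → l Fin.< k → g l ≡ 0) → g k ≡ 1) →
  (∀ k → g k ≡ 0) ⊎ tabulate g ∈ˡ rows K v
zero-or-row {zero}  g below lead = inj₁ λ ()
zero-or-row {suc v} {K} g below lead with g zero ≟ 0
... | no ≢0 = inj₂ (subst (λ a → a ∷ tabulate (g ∘ suc) ∈ˡ rows K (suc v))
                     (sym (lead zero ≢0 λ _ ()))
                     (∈-++⁺ˡ (∈-map⁺ (1 ∷_) (∈-vecs (VAll.tabulate⁺ λ k → ∈-upTo⁺ (s≤s (below (suc k))))))))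
... | yes ≡0 with zero-or-row (g ∘ suc) (below ∘ suc)
       (λ k ≢0 before → lead (suc k) ≢0 λ { zero _ → ≡0 ; (suc l) l<k → before l (s<s⁻¹ l<k) })
...   | inj₁ zeros = inj₁ λ { zero → ≡0 ; (suc k) → zeros k }
...   | inj₂ row   = inj₂ (subst (λ a → a ∷ tabulate (g ∘ suc) ∈ˡ rows K (suc v)) (sym ≡0)
                       (∈-++⁺ʳ (List.map (1 ∷_) (coefs K v)) (∈-map⁺ (0 ∷_) row)))

module FromMonic (A : ℕ → ℕ → ℕ) (isA : IsMonicSegmentedFirstEntries (toℚ A)) where
  open IsMonicSegmentedFirstEntries isA

  private
    width : ℕ → ℕ
    width n = α (suc n) ∸ α n

  -- Each row of the finite matrix `M` is a segment of some row of `A`, so finitely many rows of `A`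
  -- bound all entries in these columns.
  entry-bound : ∀ n → ∃ λ K → ∀ i (k : Fin (width n)) → A i (α n + toℕ k) ≤ K
  entry-bound n with segments n
  ... | inj₁ empty = 0 , λ i k → zero-entry i k (A i (α n + toℕ k) ≟ 0)
    where
    zero-entry : ∀ i (k : Fin (width n)) → Dec (A i (α n + toℕ k) ≡ 0) → A i (α n + toℕ k) ≤ 0
    zero-entry i k (yes ≡0) = ≤-reflexive ≡0
    zero-entry i k (no ≢0)  = ⊥-elim (empty _ ((k , λ eq → ≢0 (/1-injective eq)) , i , λ _ → refl))
  ... | inj₂ (u , M , _ , S⊆Rows , Rows⊆S) = proj₁ outer , λ i k → entry i k (A i (α n + toℕ k) ≟ 0)
    where
    row-of : Fin u → ℕ
    row-of i′ = proj₁ (proj₂ (Rows⊆S (i′ , λ _ → refl)))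

    row-of-eq : ∀ i′ k → M i′ k ≡ toℚ A (row-of i′) (α n + toℕ k)
    row-of-eq i′ = proj₂ (proj₂ (Rows⊆S (i′ , λ _ → refl)))

    inner : ∀ i′ → ∃ λ K → ∀ (k : Fin (width n)) → A (row-of i′) (α n + toℕ k) ≤ K
    inner i′ = fin-bound (λ k → A (row-of i′) (α n + toℕ k))

    outer = fin-bound (λ i′ → proj₁ (inner i′))

    entry : ∀ i (k : Fin (width n)) → Dec (A i (α n + toℕ k) ≡ 0) → A i (α n + toℕ k) ≤ proj₁ outer
    entry i k (yes ≡0) = subst (_≤ proj₁ outer) (sym ≡0) z≤n
    entry i k (no ≢0) with S⊆Rows ((k , λ eq → ≢0 (/1-injective eq)) , i , λ _ → refl)
    ... | i′ , eq = ≤-trans (≤-reflexive (/1-injective (trans (eq k) (row-of-eq i′ k))))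
                      (≤-trans (proj₂ (inner i′) k) (proj₂ outer i′))

  segmented : Segmented A
  segmented = record
    { α            = α
    ; α-zero       = α-zero
    ; α-increasing = α-increasing
    ; K            = λ n → proj₁ (entry-bound n)
    ; nonzero      = λ i → let (j , ≢0) = row-nonzero i in j , λ eq → ≢0 (cong (λ a → pos a ℚ./ 1) eq)
    ; segment-row  = λ n i → zero-or-row (λ k → A i (α n + toℕ k)) (proj₂ (entry-bound n) i)
        λ k ≢0 before → /1-injective (monic n i k
          ((λ eq → ≢0 (/1-injective eq)) , λ l l<k → cong (λ a → pos a ℚ./ 1) (before l l<k)))
    }

  support : ℕ → ℕ
  support i = proj₁ (row-finite i)

  beyond-support : ∀ i j → support i ≤ j → A i j ≡ 0
  beyond-support i j N≤j with A i j ≟ 0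
  ... | yes ≡0 = ≡0
  ... | no ≢0  = ⊥-elim (≤⇒≯ N≤j (proj₂ (row-finite i) j λ eq → ≢0 (/1-injective eq)))

-- Combining addition and multiplication

-- The semigroup ({1, 2, 3, …}, *) transported along suc.
infixl 7 _⊛_
_⊛_ : ℕ → ℕ → ℕ
a ⊛ b = b + a * suc b

⊛-isCommutativeMonoid : IsCommutativeMonoid _≡_ _⊛_ 0
⊛-isCommutativeMonoid = record
  { isMonoid = record
    { isSemigroup = record
      { isMagma = record { isEquivalence = isEquivalence ; ∙-cong = cong₂ _⊛_ }
      ; assoc   = λ a b c → suc-injective (*-assoc (suc a) (suc b) (suc c))
      }
    ; identity = (λ b → suc-injective (*-identityˡ (suc b))) , λ a → suc-injective (*-identityʳ (suc a))
    }
  ; comm = λ a b → suc-injective (*-comm (suc a) (suc b))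
  }

module _ (em : ExcludedMiddle 0ℓ) where

  open Classical em using (dne)

  private
    module Add = Ramsey em _+_ 0 +-0-isCommutativeMonoid
    module Mul = Ramsey em _⊛_ 0 ⊛-isCommutativeMonoid

  ⋆-* : ∀ a x → a Add.⋆ x ≡ a * x
  ⋆-* zero    x = refl
  ⋆-* (suc a) x = cong (x +_) (⋆-* a x)

  ⋆-^ : ∀ a x → suc (a Mul.⋆ x) ≡ suc x ^ a
  ⋆-^ zero    x = refl
  ⋆-^ (suc a) x = cong (suc x *_) (⋆-^ a x)

  Π-sum : ∀ {g h} → (∀ j → g j ≡ h j) → ∀ n → Add.Π g n ≡ sum (applyUpTo h n)
  Π-sum eq zero    = refl
  Π-sum eq (suc n) = cong₂ _+_ (eq 0) (Π-sum (eq ∘ suc) n)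

  Π-product : ∀ {g h} → (∀ j → suc (g j) ≡ h j) → ∀ n → suc (Mul.Π g n) ≡ product (applyUpTo h n)
  Π-product eq zero    = refl
  Π-product eq (suc n) = cong₂ _*_ (eq 0) (Π-product (eq ∘ suc) n)

  sum-scale : ∀ {g h} d → (∀ j → h j ≡ g j * d) → ∀ n → sum (applyUpTo h n) ≡ sum (applyUpTo g n) * d
  sum-scale d eq zero = refl
  sum-scale {g} d eq (suc n) =
    trans (cong₂ _+_ (eq 0) (sum-scale d (eq ∘ suc) n)) (sym (*-distribʳ-+ d (g 0) _))

  module _ (A : ℕ → ℕ → ℕ) (isA : IsMonicSegmentedFirstEntries (toℚ A)) where
    open FromMonic A isA

    linear-scale : ∀ x d k → linearImage A isA (λ j → x j * d) k ≡ linearImage A isA x k * d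
    linear-scale x d k = sum-scale d (λ j → sym (*-assoc (A k j) (x j) d)) (support k)

    linearImage-regular : ∀ {r} (E : Fin r → ℕ → Set) → (∀ n → 0 < n → ∃ λ i → E i n) →
      ∃ λ i → ∃ λ (x : ℕ → ℕ) → (∀ j → 0 < x j) × (∀ k → E i (linearImage A isA x k))
    linearImage-regular E cover =
      let (i , x , positive , image) = Add.coveredImage segmented (0 <_) (λ F → 1 , λ _ → z<s) E cover
      in i , x , positive , λ k → subst (E i) (Π-sum (λ j → ⋆-* (A k j) (x j)) (support k))
                                    (image k (support k) (beyond-support k))

    module _ {r} (E : Fin r → Pred ℕ 0ℓ) (cover : ∀ n → 0 < n → ∃ λ i → E i n) where

      Good : Fin r → Set
      Good i = ∃ λ (x : ℕ → ℕ) → (∀ j → 0 < x j) × (∀ k → E i (linearImage A isA x k))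

      GoodPoint : ℕ → Set
      GoodPoint a = ∃ λ i → Good i × E i (suc a)

      -- Otherwise the bad classes, divided by the elements of F, would finitely colour ℕ.
      goodPoint-thick : (F : List ℕ) → ∃ λ a → ∀ {u} → u ∈ˡ F → GoodPoint (a ⊛ u)
      goodPoint-thick F with em {∃ λ a → ∀ {u} → u ∈ˡ F → GoodPoint (a ⊛ u)}
      ... | yes thick = thick
      ... | no ¬thick =
        let (e , x , positive , image) = linearImage-regular (λ e → Quotient (remQuot r e)) quotient-cover
            d = suc (List.lookup F (proj₁ (remQuot {length F} r e)))
        -- Scaling `x` by the divisor `d` of its quotient class puts all entries into the class
        -- `E i`, which makes `i` good, whereas the entry in row 0 certifies that `i` is bad.
        in ⊥-elim (proj₁ (image 0)
             ((λ j → x j * d) , (λ j → *-mono-≤ (positive j) z<s) ,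
              λ k → subst (E _) (sym (linear-scale x d k)) (proj₂ (image k))))
        where
        Quotient : Fin (length F) × Fin r → ℕ → Set
        Quotient (l , i) n = ¬ Good i × E i (n * suc (List.lookup F l))

        bad : ∀ a → ∃ λ u → u ∈ˡ F × ¬ GoodPoint (a ⊛ u)
        bad a = dne λ none → ¬thick (a , λ {u} u∈ → dne λ ¬gp → none (u , u∈ , ¬gp))

        quotient-cover : ∀ n → 0 < n → ∃ λ e → Quotient (remQuot r e) n
        quotient-cover (suc a) _ with bad a
        ... | u , u∈ , ¬gp with cover (suc (a ⊛ u)) z<s
        ...   | i , inE = combine (index u∈) i ,
          subst (λ p → Quotient p (suc a)) (sym (remQuot-combine (index u∈) i))
            ((λ good → ¬gp (i , good , inE)) , subst (λ u → E i (suc a * suc u)) (lookup-index u∈) inE)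

theorem3p6 : ExcludedMiddle 0ℓ →
    (A : ℕ → ℕ → ℕ) (isA : IsMonicSegmentedFirstEntries (toℚ A)) →
    (r : ℕ) .{{_ : NonZero r}} (E : Fin r → Pred ℕ 0ℓ) →
    ⋃ (Fin r) E ≐ Positive →
    ∃ λ i → ∃ λ (x : ℕ → ℕ) → ∃ λ (y : ℕ → ℕ) →
    (∀ j → x j ∈ Positive) × (∀ j → y j ∈ Positive) ×
    (∀ k → linearImage A isA x k ∈ E i) ×
    (∀ k → powerImage A isA y k ∈ E i)
theorem3p6 em A isA r E (_ , Positive⊆E) =
  let (i , y , _ , image) = Mul.coveredImage segmented (GoodPoint em A isA E cover)
                              (goodPoint-thick em A isA E cover) GoodClass (λ _ → id)
      -- Already one entry in `GoodClass i` certifies that colour `i` is good, which supplies `x`.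
      ((x , x-positive , x-image) , _) = image 0 (support 0) (beyond-support 0)
  in i , x , (λ j → suc (y j)) , x-positive , (λ _ → z<s) , x-image ,
     λ k → subst (E i) (Π-product em (λ j → ⋆-^ em (A k j) (y j)) (support k))
             (proj₂ (image k (support k) (beyond-support k)))
  where
  open FromMonic A isA
  module Mul = Ramsey em _⊛_ 0 ⊛-isCommutativeMonoid

  cover : ∀ n → 0 < n → ∃ λ i → E i n
  cover n 0<n = Positive⊆E 0<n

  GoodClass : Fin r → ℕ → Set
  GoodClass i a = Good em A isA E cover i × E i (suc a)
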